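{- Let $F$ be a finite factor closed set of positive integers and let $B\ge 1$ be an integer. Let $N(B,F)$ be the number of quadruples $(n_1,n_2,n_3,n_4)$ of integers with $n_1n_2=n_3n_4$, $1\le n_1\le B$, $1\le n_3\le B$, $n_2,n_4\in F$; let $N(F,F)$ be the number of quadruples $(n_1,n_2,n_3,n_4)\in F^4$ with $n_1n_2=n_3n_4$. Then $$N(B,F)=\sum_{\substack{n,m\in F\\ \gcd(n,m)=1}}\Big(\sum_{\substack{\mu,\nu\in F\\ \nu/\mu=m/n}}1\Big)\Big\lfloor\frac{B}{\max(n,m)}\Big\rfloor .$$ If moreover $F\subset[1,B]$, then $$N(B,F)\le 2B^2\sum_{\substack{n\in F\\ n\ne 1}}\frac1n+B^2,$$ $$N(B,F)\ge\sum_{\mu,\nu\in F}\gcd(\mu,\nu),$$ $$N(F,F)=\sum_{\substack{n,m\in F\\ \gcd(n,m)=1}}\Big(\sum_{\substack{n_2,n_4\in F\\ n_4/n_2=m/n}}1\Big)^2 .$$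
   Context: A finite set $F$ of positive integers is called factor closed (an FC set) if for every $k\in F$ and every positive divisor $d$ of $k$ one has $d\in F$; in particular $1\in F$ (so $F$ is nonempty). Sums over $n,m\in F$ (or $\mu,\nu\in F$, or $n_2,n_4\in F$) run over ordered pairs. $\lfloor x\rfloor$ is the integer part of $x$. -}

module Defs where

open import Data.Nat using (ℕ; zero; suc; _*_; _≤_; NonZero)
import Data.Nat as ℕ
open import Data.Nat.Divisibility using (_∣_)
open import Data.Nat.GCD using (gcd)
open import Data.Integer using (+_)
open import Data.Rational using (ℚ; 0ℚ)
import Data.Rational as ℚ
open import Data.List using (List; applyUpTo; cartesianProduct; filter; foldr; length; map)
open import Data.Nat.ListAction using (sum)
open import Data.List.Membership.Propositional using (_∈_)
open import Data.List.Relation.Unary.All using (All)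
open import Data.List.Relation.Unary.Unique.Propositional using (Unique)
open import Data.Product using (_×_; _,_)
open import Relation.Nullary.Decidable using (¬?)

-- A finite set of naturals is a duplicate-free list, so that sums and counts
-- over the list are sums and counts over the set.
record FactorClosed (F : List ℕ) : Set where
  field
    unique   : Unique F
    positive : All NonZero F
    one∈     : 1 ∈ F
    closed   : ∀ {k d} → k ∈ F → d ∣ k → d ∈ F

_⊂[1,_] : List ℕ → ℕ → Set
F ⊂[1, B ] = All (λ k → 1 ≤ k × k ≤ B) F

-- a / b as a rational and its integer part ⌊a / b⌋.  The values at b = 0 are
-- junk, never reached below because denominators come from sets of positive
-- integers.
frac : ℕ → ℕ → ℚ
frac a zero    = 0ℚ
frac a (suc b) = (+ a) ℚ./ suc b

⌊_/_⌋ : ℕ → ℕ → ℕ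
⌊ a / zero ⌋  = 0
⌊ a / suc b ⌋ = a ℕ./ suc b

fromℕ : ℕ → ℚ
fromℕ a = frac a 1

∑ : ∀ {A : Set} → List A → (A → ℕ) → ℕ
∑ xs f = sum (map f xs)

∑ℚ : ∀ {A : Set} → List A → (A → ℚ) → ℚ
∑ℚ xs f = foldr ℚ._+_ 0ℚ (map f xs)


[1⋯_] : ℕ → List ℕ
[1⋯ B ] = applyUpTo suc B

pairs : List ℕ → List (ℕ × ℕ)
pairs F = cartesianProduct F F

coprimePairs : List ℕ → List (ℕ × ℕ)
coprimePairs F = filter (λ (n , m) → gcd n m ℕ.≟ 1) (pairs F)

-- The number of quadruples (n₁ , n₂ , n₃ , n₄) with n₁ n₂ = n₃ n₄,
-- n₁ , n₃ ∈ X and n₂ , n₄ ∈ Y.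
N : List ℕ → List ℕ → ℕ
N X Y = length
  (filter (λ (n₁ , n₂ , n₃ , n₄) → n₁ * n₂ ℕ.≟ n₃ * n₄)
          (cartesianProduct X (cartesianProduct Y (cartesianProduct X Y))))

-- The number of (μ , ν) ∈ F × F with ν / μ = m / n.
ratioCount : List ℕ → ℕ → ℕ → ℕ
ratioCount F n m = length
  (filter (λ (μ , ν) → frac ν μ ℚ.≟ frac m n) (pairs F))

without1 : List ℕ → List ℕ
without1 = filter (λ n → ¬? (n ℕ.≟ 1))

{-# OPTIONS --safe #-}
-- Group the pairs (μ , ν) ∈ F × F by the reduced form m / n of ν / μ, which
-- stays inside F because F is factor closed.  The equation a μ = b ν depends only
-- on the class (n , m), so N X F is the sum over coprime (n , m) of the class size
-- times the number of (a , b) ∈ X × X with a n = b m.  For coprime n and m these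
-- solutions are (k m , k n), whence ⌊ B / max(n , m) ⌋ of them in [1 , B], and for
-- X = F their number is again the class size.  If F ⊂ [1 , B], a class therefore has
-- size at most ⌊ B / max(n , m) ⌋; as at most 2 k pairs have maximum k, the upper
-- bound follows from 2 k ⌊ B / k ⌋² ≤ 2 B² / k.
module Submission where

open import Data.Bool using (true; false; if_then_else_)
import Data.Integer as ℤ
import Data.Integer.Properties as ℤ
open import Data.List using (List; []; _∷_; _++_; length; map; filter; cartesianProduct; concatMap)
open import Data.List.Membership.Propositional using (_∈_)
open import Data.List.Membership.Propositional.Properties
  using (∈-∃++; ∈-++⁺ˡ; ∈-++⁺ʳ; ∈-++⁻; ∈-map⁺; ∈-map⁻; ∈-filter⁺; ∈-filter⁻; ∈-concatMap⁺;
         ∈-cartesianProduct⁺; ∈-cartesianProduct⁻; ∈-applyUpTo⁺; ∈-applyUpTo⁻)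
open import Data.List.Properties using (length-map; length-applyUpTo; map-++)
open import Data.List.Relation.Binary.Subset.Propositional using (_⊆_)
open import Data.List.Relation.Unary.All using (All; []; _∷_)
import Data.List.Relation.Unary.All as All
open import Data.List.Relation.Unary.AllPairs using ([]; _∷_)
open import Data.List.Relation.Unary.Any using (here; there)
import Data.List.Relation.Unary.Any as Any
open import Data.List.Relation.Unary.Unique.Propositional using (Unique)
import Data.List.Relation.Unary.Unique.Propositional.Properties as Unique
open import Data.Nat using (ℕ; zero; suc; _+_; _*_; _^_; _≤_; _≥_; _⊔_; NonZero; z≤n; s≤s; >-nonZero; >-nonZero⁻¹)
import Data.Nat as ℕ
open import Data.Nat.Coprimality using (Coprime; coprime-divisor; coprime⇒gcd≡1; gcd≡1⇒coprime; coprime-/gcd)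
import Data.Nat.Coprimality as Coprime
open import Data.Nat.Divisibility using (divides; ∣-antisym)
open import Data.Nat.DivMod using (m/n*n≤m; m/n*n≡m; m*n/n≡m; /-monoˡ-≤)
open import Data.Nat.GCD using (gcd; gcd[m,n]∣m; gcd[m,n]∣n; gcd[m,n]≢0)
open import Data.Nat.ListAction using (sum)
open import Data.Nat.ListAction.Properties using (sum-++)
open import Data.Nat.Properties
open import Data.Nat.Tactic.RingSolver using (solve-∀)
open import Algebra.Properties.CommutativeSemigroup +-commutativeSemigroup using (interchange; x∙yz≈y∙xz)
import Data.Rational as ℚ
import Data.Rational.Properties as ℚ
open import Data.Rational.Unnormalised using (mkℚᵘ; *≡*; *≤*)
import Data.Rational.Unnormalised as ℚᵘ
import Data.Rational.Unnormalised.Properties as ℚᵘ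
open import Data.Product using (_×_; _,_; proj₁; proj₂; ∃; ∃₂; swap)
open import Data.Sum using (inj₁; inj₂)
open import Function using (_∋_)
open import Relation.Binary.PropositionalEquality using (_≡_; refl; sym; trans; cong; cong₂; subst; module ≡-Reasoning)
open import Relation.Nullary using (Dec; yes; no; does; contradiction)
open import Relation.Nullary.Decidable using (¬?)
open import Relation.Unary using (Pred; Decidable)
open import Defs

-- Finite sums over lists, and counting by inclusion.

private variable
  A C : Set

𝟙 : ∀ {p} {P : Set p} → Dec P → ℕ
𝟙 P? = if does P? then 1 else 0

∑-cong : ∀ (xs : List A) {f g : A → ℕ} → (∀ {x} → x ∈ xs → f x ≡ g x) → ∑ xs f ≡ ∑ xs g
∑-cong []       eq = refl
∑-cong (x ∷ xs) eq = cong₂ _+_ (eq (here refl)) (∑-cong xs (λ x∈ → eq (there x∈)))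

∑-mono-≤ : ∀ (xs : List A) {f g : A → ℕ} → (∀ {x} → x ∈ xs → f x ≤ g x) → ∑ xs f ≤ ∑ xs g
∑-mono-≤ []       le = z≤n
∑-mono-≤ (x ∷ xs) le = +-mono-≤ (le (here refl)) (∑-mono-≤ xs (λ x∈ → le (there x∈)))

∑-++ : ∀ (xs ys : List A) (f : A → ℕ) → ∑ (xs ++ ys) f ≡ ∑ xs f + ∑ ys f
∑-++ xs ys f = trans (cong sum (map-++ f xs ys)) (sum-++ (map f xs) (map f ys))

∑-map : ∀ (xs : List A) (h : A → C) (f : C → ℕ) → ∑ (map h xs) f ≡ ∑ xs (λ x → f (h x))
∑-map []       h f = refl
∑-map (x ∷ xs) h f = cong (f (h x) +_) (∑-map xs h f)

∑-zero : ∀ (xs : List A) → ∑ xs (λ _ → 0) ≡ 0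
∑-zero []       = refl
∑-zero (x ∷ xs) = ∑-zero xs

∑-+ : ∀ (xs : List A) (f g : A → ℕ) → ∑ xs (λ x → f x + g x) ≡ ∑ xs f + ∑ xs g
∑-+ []       f g = refl
∑-+ (x ∷ xs) f g = trans (cong (f x + g x +_) (∑-+ xs f g)) (interchange (f x) (g x) _ _)

∑-*ʳ : ∀ (xs : List A) (f : A → ℕ) c → ∑ xs (λ x → f x * c) ≡ ∑ xs f * c
∑-*ʳ []       f c = refl
∑-*ʳ (x ∷ xs) f c = trans (cong (f x * c +_) (∑-*ʳ xs f c)) (sym (*-distribʳ-+ c (f x) _))

∑-comm : ∀ (xs : List A) (ys : List C) (f : A → C → ℕ) →
         ∑ xs (λ x → ∑ ys (f x)) ≡ ∑ ys (λ y → ∑ xs (λ x → f x y))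
∑-comm []       ys f = sym (∑-zero ys)
∑-comm (x ∷ xs) ys f = trans (cong (∑ ys (f x) +_) (∑-comm xs ys f)) (sym (∑-+ ys (f x) _))

∑-concatMap : ∀ (xs : List A) (h : A → List C) (f : C → ℕ) →
              ∑ (concatMap h xs) f ≡ ∑ xs (λ x → ∑ (h x) f)
∑-concatMap []       h f = refl
∑-concatMap (x ∷ xs) h f = trans (∑-++ (h x) _ f) (cong (∑ (h x) f +_) (∑-concatMap xs h f))

∑-cartesianProduct : ∀ (xs : List A) (ys : List C) (f : A × C → ℕ) →
                     ∑ (cartesianProduct xs ys) f ≡ ∑ xs (λ x → ∑ ys (λ y → f (x , y)))
∑-cartesianProduct []       ys f = refl
∑-cartesianProduct (x ∷ xs) ys f =
  trans (∑-++ (map (x ,_) ys) _ f) (cong₂ _+_ (∑-map ys (x ,_) f) (∑-cartesianProduct xs ys f))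

∑-const : ∀ (xs : List A) c → ∑ xs (λ _ → c) ≡ length xs * c
∑-const []       c = refl
∑-const (x ∷ xs) c = cong (c +_) (∑-const xs c)

-- Induction on `xs`: cut one occurrence of its head out of `ys`; since `xs` has no repetitions, its
-- tail still lies in what remains. The list `ys` may repeat entries, as the cover of `pairs F` in
-- `∑-pairs-max` does.
∑-⊆ : ∀ {xs ys : List A} (f : A → ℕ) → Unique xs → xs ⊆ ys → ∑ xs f ≤ ∑ ys f
∑-⊆ {xs = []}     f _          _  = z≤n
∑-⊆ {xs = x ∷ xs} f (x∉ ∷ xs!) xs⊆ with ∈-∃++ (xs⊆ (here refl))
... | us , vs , refl = begin
  f x + ∑ xs f             ≤⟨ +-monoʳ-≤ (f x) (∑-⊆ f xs! xs⊆us++vs) ⟩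
  f x + ∑ (us ++ vs) f     ≡⟨ cong (f x +_) (∑-++ us vs f) ⟩
  f x + (∑ us f + ∑ vs f)  ≡⟨ x∙yz≈y∙xz (f x) (∑ us f) _ ⟩
  ∑ us f + (f x + ∑ vs f)  ≡⟨ ∑-++ us (x ∷ vs) f ⟨
  ∑ (us ++ x ∷ vs) f       ∎
  where
  open ≤-Reasoning
  xs⊆us++vs : xs ⊆ us ++ vs
  xs⊆us++vs y∈xs with ∈-++⁻ us (xs⊆ (there y∈xs))
  ... | inj₁ y∈us            = ∈-++⁺ˡ y∈us
  ... | inj₂ (here refl)     = contradiction refl (All.lookup x∉ y∈xs)
  ... | inj₂ (there y∈vs)    = ∈-++⁺ʳ us y∈vs

length-⊆ : ∀ {xs ys : List A} → Unique xs → xs ⊆ ys → length xs ≤ length ys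
length-⊆ {xs = xs} {ys} xs! xs⊆ys = begin
  length xs       ≡⟨ *-identityʳ _ ⟨
  length xs * 1   ≡⟨ ∑-const xs 1 ⟨
  ∑ xs (λ _ → 1)  ≤⟨ ∑-⊆ _ xs! xs⊆ys ⟩
  ∑ ys (λ _ → 1)  ≡⟨ ∑-const ys 1 ⟩
  length ys * 1   ≡⟨ *-identityʳ _ ⟩
  length ys       ∎
  where open ≤-Reasoning

length-injection : ∀ {xs : List A} {ys : List C} (f : A → C) → (∀ {x y} → f x ≡ f y → x ≡ y) →
                   Unique xs → (∀ {x} → x ∈ xs → f x ∈ ys) → length xs ≤ length ys
length-injection {xs = xs} {ys} f f-inj xs! f∈ =
  subst (_≤ length ys) (length-map f xs) (length-⊆ (Unique.map⁺ f-inj xs!) map⊆ys)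
  where
  map⊆ys : map f xs ⊆ ys
  map⊆ys z∈ with ∈-map⁻ f z∈
  ... | _ , x∈ , refl = f∈ x∈

length-filter : ∀ {p} {P : Pred A p} (P? : Decidable P) xs →
                length (filter P? xs) ≡ ∑ xs (λ x → 𝟙 (P? x))
length-filter P? []       = refl
length-filter P? (x ∷ xs) with does (P? x)
... | true  = cong suc (length-filter P? xs)
... | false = length-filter P? xs

-- The filtered list and `x ∷ []` are duplicate-free and contain each other, so exactly one term
-- survives. This later picks out the single reduced fraction that represents a class.
∑-singleton : ∀ {p} {P : Pred A p} (P? : Decidable P) {xs x} (g : A → ℕ) {c} →
              Unique xs → x ∈ xs → P x → (∀ {y} → y ∈ xs → P y → y ≡ x) → g x ≡ c →
              ∑ xs (λ y → 𝟙 (P? y) * g y) ≡ c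
∑-singleton P? {xs} {x} g {c} xs! x∈ Px P⇒≡x gx≡c = begin
  ∑ xs (λ y → 𝟙 (P? y) * g y)  ≡⟨ ∑-cong xs constant ⟩
  ∑ xs (λ y → 𝟙 (P? y) * c)    ≡⟨ ∑-*ʳ xs _ c ⟩
  ∑ xs (λ y → 𝟙 (P? y)) * c    ≡⟨ cong (_* c) (length-filter P? xs) ⟨
  length (filter P? xs) * c    ≡⟨ cong (_* c) (≤-antisym (length-⊆ (Unique.filter⁺ P? xs!) filter⊆[x])
                                                         (length-⊆ {xs = x ∷ []} ([] ∷ []) [x]⊆filter)) ⟩
  1 * c                        ≡⟨ *-identityˡ c ⟩
  c                            ∎
  where
  open ≡-Reasoning
  constant : ∀ {y} → y ∈ xs → 𝟙 (P? y) * g y ≡ 𝟙 (P? y) * c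
  constant {y} y∈ with P? y
  ... | yes Py = cong (1 *_) (trans (cong g (P⇒≡x y∈ Py)) gx≡c)
  ... | no  _  = refl
  filter⊆[x] : filter P? xs ⊆ x ∷ []
  filter⊆[x] y∈ = let y∈xs , Py = ∈-filter⁻ P? y∈ in here (P⇒≡x y∈xs Py)
  [x]⊆filter : x ∷ [] ⊆ filter P? xs
  [x]⊆filter (here refl) = ∈-filter⁺ P? x∈ Px

-- Intervals, integer parts and fractions.

∈-[1⋯]⁺ : ∀ {B k} → 1 ≤ k → k ≤ B → k ∈ [1⋯ B ]
∈-[1⋯]⁺ {k = suc k} _ k<B = ∈-applyUpTo⁺ suc k<B

∈-[1⋯]⁻ : ∀ {B k} → k ∈ [1⋯ B ] → 1 ≤ k × k ≤ B
∈-[1⋯]⁻ k∈ with ∈-applyUpTo⁻ suc k∈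
... | _ , i<B , refl = s≤s z≤n , i<B

[1⋯]-unique : ∀ B → Unique [1⋯ B ]
[1⋯]-unique B = Unique.applyUpTo⁺₁ suc B (λ i<j _ eq → <⇒≢ i<j (suc-injective eq))

pairs-unique : ∀ {X} → Unique X → Unique (pairs X)
pairs-unique X! = Unique.cartesianProduct⁺ X! X!

-- Together with `⌊/⌋-upper` this makes `⌊ B / k ⌋` the largest `j` with `j * k ≤ B`; the junk value
-- at `k = 0` would violate it.
⌊/⌋-lower : ∀ {j k} B → NonZero k → j * k ≤ B → j ≤ ⌊ B / k ⌋
⌊/⌋-lower {j} {k@(suc _)} B _ jk≤B = subst (_≤ B ℕ./ k) (m*n/n≡m j k) (/-monoˡ-≤ k jk≤B)

⌊/⌋-upper : ∀ B k → ⌊ B / k ⌋ * k ≤ B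
⌊/⌋-upper B zero    = z≤n
⌊/⌋-upper B (suc k) = m/n*n≤m B (suc k)

-- For a positive denominator `frac` unfolds to `fromℚᵘ` of an unnormalised fraction, and equality
-- of those is cross multiplication in ℤ.
frac-≡⁺ : ∀ {a b c d} → NonZero b → NonZero d → a * d ≡ c * b → frac a b ≡ frac c d
frac-≡⁺ {a} {suc b} {c} {suc d} _ _ eq = ℚ.fromℚᵘ-cong {mkℚᵘ (ℤ.+ a) b} {mkℚᵘ (ℤ.+ c) d}
  (*≡* (trans (sym (ℤ.pos-* a (suc d))) (trans (cong ℤ.+_ eq) (ℤ.pos-* c (suc b)))))

frac-≡⁻ : ∀ {a b c d} → NonZero b → NonZero d → frac a b ≡ frac c d → a * d ≡ c * b
frac-≡⁻ {a} {suc b} {c} {suc d} _ _ eq with ℚ.fromℚᵘ-injective {mkℚᵘ (ℤ.+ a) b} {mkℚᵘ (ℤ.+ c) d} eq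
... | *≡* eq′ = ℤ.+-injective (trans (ℤ.pos-* a (suc d)) (trans eq′ (sym (ℤ.pos-* c (suc b)))))

-- Solutions of `a * μ ≡ b * ν`.

-- These are the pairs (n₁ , n₃) that complete a fixed (n₂ , n₄) = (μ , ν) to a quadruple counted by
-- `N`.
solutions : List ℕ → ℕ → ℕ → List (ℕ × ℕ)
solutions X μ ν = filter (λ (a , b) → a * μ ℕ.≟ b * ν) (pairs X)

solutionCount : List ℕ → ℕ → ℕ → ℕ
solutionCount X μ ν = length (solutions X μ ν)

∈-solutions⁺ : ∀ X μ ν {a b} → a ∈ X → b ∈ X → a * μ ≡ b * ν → (a , b) ∈ solutions X μ ν
∈-solutions⁺ X μ ν a∈ b∈ eq = ∈-filter⁺ _ (∈-cartesianProduct⁺ a∈ b∈) eq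

∈-solutions⁻ : ∀ X μ ν {a b} → (a , b) ∈ solutions X μ ν → a ∈ X × b ∈ X × a * μ ≡ b * ν
∈-solutions⁻ X μ ν ab∈ with ∈-filter⁻ (λ (a , b) → a * μ ℕ.≟ b * ν) {xs = pairs X} ab∈
... | ab∈pairs , eq = let a∈ , b∈ = ∈-cartesianProduct⁻ X X ab∈pairs in a∈ , b∈ , eq

solutions-unique : ∀ {X} μ ν → Unique X → Unique (solutions X μ ν)
solutions-unique μ ν X! = Unique.filter⁺ _ (pairs-unique X!)

solutionCount-⊆ : ∀ {X Y} μ ν → Unique X → X ⊆ Y → solutionCount X μ ν ≤ solutionCount Y μ ν
solutionCount-⊆ {X} {Y} μ ν X! X⊆Y = length-⊆ (solutions-unique μ ν X!) λ ab∈ →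
  let a∈ , b∈ , eq = ∈-solutions⁻ X μ ν ab∈ in ∈-solutions⁺ Y μ ν (X⊆Y a∈) (X⊆Y b∈) eq

proportional-≡ : ∀ {a b μ ν n m} → NonZero μ → ν * n ≡ m * μ → a * μ ≡ b * ν → a * n ≡ b * m
proportional-≡ {a} {b} {μ} {ν} {n} {m} μ≢0 νn≡mμ aμ≡bν = *-cancelʳ-≡ (a * n) (b * m) μ {{μ≢0}} (begin
  a * n * μ    ≡⟨ ((∀ a n μ → a * n * μ ≡ a * μ * n) ∋ solve-∀) a n μ ⟩
  a * μ * n    ≡⟨ cong (_* n) aμ≡bν ⟩
  b * ν * n    ≡⟨ *-assoc b ν n ⟩
  b * (ν * n)  ≡⟨ cong (b *_) νn≡mμ ⟩
  b * (m * μ)  ≡⟨ *-assoc b m μ ⟨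
  b * m * μ    ∎)
  where open ≡-Reasoning

-- The relation `ν * n ≡ m * μ` is symmetric in (μ , ν) and (n , m), so one inclusion of solution
-- sets, used twice, gives equality.
solutionCount-proportional : ∀ {X μ ν n m} → Unique X → NonZero μ → NonZero n → ν * n ≡ m * μ →
                             solutionCount X μ ν ≡ solutionCount X n m
solutionCount-proportional {X} X! μ≢0 n≢0 eq = ≤-antisym (half μ≢0 eq) (half n≢0 (sym eq))
  where
  half : ∀ {μ ν n m} → NonZero μ → ν * n ≡ m * μ → solutionCount X μ ν ≤ solutionCount X n m
  half {μ} {ν} {n} {m} μ≢0 eq = length-⊆ {ys = solutions X n m} (solutions-unique μ ν X!) λ {(a , b)} ab∈ →
    let a∈ , b∈ , eq′ = ∈-solutions⁻ X μ ν ab∈ in ∈-solutions⁺ X n m a∈ b∈ (proportional-≡ {a} {b} μ≢0 eq eq′)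

-- Since `m` divides `n * a` and is coprime to `n`, it divides `a`; the quotient is `k`, and
-- cancelling `m` in the equation gives `b`.
coprime-solution : ∀ {n m a b} → Coprime n m → NonZero m → a * n ≡ b * m → ∃ λ k → a ≡ k * m × b ≡ k * n
coprime-solution {n} {m} {a} {b} n⊥m m≢0 eq
  with coprime-divisor (Coprime.sym n⊥m) (divides b (trans (*-comm n a) eq))
... | divides k refl = k , refl , *-cancelʳ-≡ b (k * n) m {{m≢0}}
  (trans (sym eq) (((∀ k m n → k * m * n ≡ k * n * m) ∋ solve-∀) k m n))

-- The map `multiple` is a bijection from [1 , q] to the solutions: both `k * m` and `k * n` are at
-- most `B` exactly when `k * (n ⊔ m) ≤ B`, that is, when `k ≤ q`.
solutionCount-coprime : ∀ B {n m} → Coprime n m → NonZero n → NonZero m →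
                        solutionCount [1⋯ B ] n m ≡ ⌊ B / n ⊔ m ⌋
solutionCount-coprime B {n} {m} n⊥m n≢0 m≢0 = ≤-antisym
  (subst (solutionCount [1⋯ B ] n m ≤_) (trans (length-map multiple [1⋯ q ]) (length-applyUpTo suc q))
    (length-⊆ (solutions-unique n m ([1⋯]-unique B)) solutions⊆))
  (subst (_≤ solutionCount [1⋯ B ] n m) (length-applyUpTo suc q)
    (length-injection multiple multiple-injective ([1⋯]-unique q) multiple∈))
  where
  q = ⌊ B / n ⊔ m ⌋
  multiple : ℕ → ℕ × ℕ
  multiple k = k * m , k * n
  multiple-injective : ∀ {j k} → multiple j ≡ multiple k → j ≡ k
  multiple-injective {j} {k} eq = *-cancelʳ-≡ j k m {{m≢0}} (cong proj₁ eq)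
  solutions⊆ : solutions [1⋯ B ] n m ⊆ map multiple [1⋯ q ]
  solutions⊆ {a , b} ab∈ with ∈-solutions⁻ [1⋯ B ] n m ab∈
  ... | a∈ , b∈ , eq with coprime-solution {a = a} {b} n⊥m m≢0 eq
  ... | k , refl , refl = ∈-map⁺ multiple (∈-[1⋯]⁺ 1≤k (⌊/⌋-lower B n⊔m≢0 k*[n⊔m]≤B))
    where
    n⊔m≢0 : NonZero (n ⊔ m)
    n⊔m≢0 = >-nonZero (≤-trans (>-nonZero⁻¹ n {{n≢0}}) (m≤m⊔n n m))
    -- Here `k` cannot be 0, because `k * m` is the positive first coordinate of the solution.
    1≤k : 1 ≤ k
    1≤k = >-nonZero⁻¹ k {{m*n≢0⇒m≢0 k {m} {{>-nonZero (proj₁ (∈-[1⋯]⁻ a∈))}}}}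
    k*[n⊔m]≤B : k * (n ⊔ m) ≤ B
    k*[n⊔m]≤B = subst (_≤ B) (sym (*-distribˡ-⊔ k n m)) (⊔-lub (proj₂ (∈-[1⋯]⁻ b∈)) (proj₂ (∈-[1⋯]⁻ a∈)))
  multiple∈ : ∀ {k} → k ∈ [1⋯ q ] → multiple k ∈ solutions [1⋯ B ] n m
  multiple∈ {k} k∈ = ∈-solutions⁺ [1⋯ B ] n m (inRange m≢0 (m≤n⊔m n m)) (inRange n≢0 (m≤m⊔n n m))
      (((∀ k m n → k * m * n ≡ k * n * m) ∋ solve-∀) k m n)
    where
    inRange : ∀ {l} → NonZero l → l ≤ n ⊔ m → k * l ∈ [1⋯ B ]
    inRange {l} l≢0 l≤ = let 1≤k , k≤q = ∈-[1⋯]⁻ k∈ in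
      ∈-[1⋯]⁺ (*-mono-≤ 1≤k (>-nonZero⁻¹ l {{l≢0}})) (≤-trans (*-mono-≤ k≤q l≤) (⌊/⌋-upper B (n ⊔ m)))

-- Reduced fractions.

-- Both entries are divided by their gcd, which is nonzero because `μ` is. The factorisations
-- exhibit `n` and `m` as divisors; the cross-multiplied equation is the form that
-- `solutionCount-proportional` takes.
coprime-reduction : ∀ {μ ν} → NonZero μ →
                    ∃₂ λ n m → μ ≡ n * gcd μ ν × ν ≡ m * gcd μ ν × ν * n ≡ m * μ × Coprime n m
coprime-reduction {μ} {ν} μ≢0 = n , m , sym n*g≡μ , sym m*g≡ν , νn≡mμ , coprime-/gcd μ ν
  where
  g = gcd μ ν
  instance
    g≢0 : NonZero g
    g≢0 = ℕ.≢-nonZero (gcd[m,n]≢0 μ ν (inj₁ (ℕ.≢-nonZero⁻¹ μ {{μ≢0}})))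
  n = μ ℕ./ g
  m = ν ℕ./ g
  n*g≡μ : n * g ≡ μ
  n*g≡μ = m/n*n≡m (gcd[m,n]∣m μ ν)
  m*g≡ν : m * g ≡ ν
  m*g≡ν = m/n*n≡m (gcd[m,n]∣n μ ν)
  νn≡mμ : ν * n ≡ m * μ
  νn≡mμ = begin
    ν * n        ≡⟨ cong (_* n) m*g≡ν ⟨
    m * g * n    ≡⟨ ((∀ m g n → m * g * n ≡ m * (n * g)) ∋ solve-∀) m g n ⟩
    m * (n * g)  ≡⟨ cong (m *_) n*g≡μ ⟩
    m * μ        ∎
    where open ≡-Reasoning

-- Coprimality turns the one equation into four divisibilities: `n` and `n′` divide each other, and
-- so do `m` and `m′`.
coprime-fraction-unique : ∀ {n m n′ m′} → Coprime n m → Coprime n′ m′ → m * n′ ≡ m′ * n → n ≡ n′ × m ≡ m′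
coprime-fraction-unique {n} {m} {n′} {m′} n⊥m n′⊥m′ eq =
  ∣-antisym (coprime-divisor n⊥m (divides m′ eq))
            (coprime-divisor n′⊥m′ (divides m (sym eq))) ,
  ∣-antisym (coprime-divisor (Coprime.sym n⊥m) (divides n′ (trans (*-comm n m′) (trans (sym eq) (*-comm m n′)))))
            (coprime-divisor (Coprime.sym n′⊥m′) (divides n (trans (*-comm n′ m) (trans eq (*-comm m′ n)))))

-- Counting quadruples through the pairs (n₂ , n₄).

-- The count becomes a fourfold sum of indicators; interchanging summations moves the two variables
-- from `Y` outside, and the inner double sum over `X` is a solution count.
N≡∑-solutionCount : ∀ X Y → N X Y ≡ ∑ (pairs Y) (λ (μ , ν) → solutionCount X μ ν)
N≡∑-solutionCount X Y = begin
  N X Y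
    ≡⟨ length-filter _ (cartesianProduct X (cartesianProduct Y (cartesianProduct X Y))) ⟩
  ∑ (cartesianProduct X (cartesianProduct Y (cartesianProduct X Y))) _
    ≡⟨ ∑-cartesianProduct X _ _ ⟩
  ∑ X (λ a → ∑ (cartesianProduct Y (cartesianProduct X Y)) (λ (μ , b , ν) → e a μ b ν))
    ≡⟨ ∑-cong X (λ _ → trans (∑-cartesianProduct Y _ _) (∑-cong Y (λ _ →
         trans (∑-cartesianProduct X Y _) (∑-comm X Y _)))) ⟩
  ∑ X (λ a → ∑ Y (λ μ → ∑ Y (λ ν → ∑ X (λ b → e a μ b ν))))
    ≡⟨ ∑-comm X Y _ ⟩
  ∑ Y (λ μ → ∑ X (λ a → ∑ Y (λ ν → ∑ X (λ b → e a μ b ν))))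
    ≡⟨ ∑-cong Y (λ _ → ∑-comm X Y _) ⟩
  ∑ Y (λ μ → ∑ Y (λ ν → ∑ X (λ a → ∑ X (λ b → e a μ b ν))))
    ≡⟨ ∑-cong Y (λ _ → ∑-cong Y (λ _ →
         trans (sym (∑-cartesianProduct X X _)) (sym (length-filter _ (pairs X))))) ⟩
  ∑ Y (λ μ → ∑ Y (λ ν → solutionCount X μ ν))
    ≡⟨ ∑-cartesianProduct Y Y _ ⟨
  ∑ (pairs Y) (λ (μ , ν) → solutionCount X μ ν)
    ∎
  where
  open ≡-Reasoning
  e : ℕ → ℕ → ℕ → ℕ → ℕ
  e a μ b ν = 𝟙 (a * μ ℕ.≟ b * ν)

-- Write `μ = n * g` and `ν = m * g` with `g` the gcd. The solutions are counted by `⌊ B / n ⊔ m ⌋`,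
-- and `g * (n ⊔ m) = μ ⊔ ν ≤ B`, so there are at least `g` of them.
solutionCount-gcd : ∀ {B μ ν} → 1 ≤ μ × μ ≤ B → 1 ≤ ν × ν ≤ B → gcd μ ν ≤ solutionCount [1⋯ B ] μ ν
solutionCount-gcd {B} {μ} {ν} (1≤μ , μ≤B) (1≤ν , ν≤B)
  with coprime-reduction {μ} {ν} (>-nonZero 1≤μ)
... | n , m , μ≡ , ν≡ , νn≡mμ , n⊥m = begin
  g                           ≤⟨ ⌊/⌋-lower B n⊔m≢0 g*[n⊔m]≤B ⟩
  ⌊ B / n ⊔ m ⌋               ≡⟨ solutionCount-coprime B n⊥m n≢0 m≢0 ⟨
  solutionCount [1⋯ B ] n m   ≡⟨ solutionCount-proportional ([1⋯]-unique B) (>-nonZero 1≤μ) n≢0 νn≡mμ ⟨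
  solutionCount [1⋯ B ] μ ν   ∎
  where
  open ≤-Reasoning
  g = gcd μ ν
  n≢0 : NonZero n
  n≢0 = m*n≢0⇒m≢0 n {g} {{subst NonZero μ≡ (>-nonZero 1≤μ)}}
  m≢0 : NonZero m
  m≢0 = m*n≢0⇒m≢0 m {g} {{subst NonZero ν≡ (>-nonZero 1≤ν)}}
  n⊔m≢0 : NonZero (n ⊔ m)
  n⊔m≢0 = >-nonZero (≤-trans (>-nonZero⁻¹ n {{n≢0}}) (m≤m⊔n n m))
  g*[n⊔m]≤B : g * (n ⊔ m) ≤ B
  g*[n⊔m]≤B = subst (_≤ B) (trans (cong₂ _⊔_ (trans μ≡ (*-comm n g)) (trans ν≡ (*-comm m g))) (sym (*-distribˡ-⊔ g n m)))
    (⊔-lub μ≤B ν≤B)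

-- Pairs grouped by their maximum.

-- A pair with maximum `k` lies in `hook k`, which has `2 * k` entries. Maximum 1 is split off,
-- since (1 , 1) is the only such pair; this yields the single term `f 1`.
∑-pairs-max : ∀ F (f : ℕ → ℕ) → Unique F → All NonZero F →
              ∑ (pairs F) (λ (n , m) → f (n ⊔ m)) ≤ ∑ (without1 F) (λ k → 2 * k * f k) + f 1
∑-pairs-max F f F! F>0 = begin
  ∑ (pairs F) f⊔                                      ≤⟨ ∑-⊆ f⊔ (pairs-unique F!) pairs⊆ ⟩
  f 1 + ∑ (concatMap hook (without1 F)) f⊔            ≡⟨ +-comm (f 1) _ ⟩
  ∑ (concatMap hook (without1 F)) f⊔ + f 1            ≡⟨ cong (_+ f 1) (∑-concatMap (without1 F) hook f⊔) ⟩
  ∑ (without1 F) (λ k → ∑ (hook k) f⊔) + f 1          ≡⟨ cong (_+ f 1) (∑-cong (without1 F) (λ {k} _ → ∑-hook k)) ⟩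
  ∑ (without1 F) (λ k → 2 * k * f k) + f 1            ∎
  where
  open ≤-Reasoning
  f⊔ : ℕ × ℕ → ℕ
  f⊔ (n , m) = f (n ⊔ m)
  -- The pairs of positive integers with maximum k, with (k , k) listed twice.
  hook : ℕ → List (ℕ × ℕ)
  hook k = map (k ,_) [1⋯ k ] ++ map (_, k) [1⋯ k ]
  ∑-leg : ∀ k (h : ℕ → ℕ × ℕ) → (∀ {j} → j ≤ k → f⊔ (h j) ≡ f k) → ∑ (map h [1⋯ k ]) f⊔ ≡ k * f k
  ∑-leg k h f⊔≡ = begin-equality
    ∑ (map h [1⋯ k ]) f⊔         ≡⟨ ∑-map [1⋯ k ] h f⊔ ⟩
    ∑ [1⋯ k ] (λ j → f⊔ (h j))   ≡⟨ ∑-cong [1⋯ k ] (λ j∈ → f⊔≡ (proj₂ (∈-[1⋯]⁻ j∈))) ⟩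
    ∑ [1⋯ k ] (λ _ → f k)        ≡⟨ ∑-const [1⋯ k ] (f k) ⟩
    length [1⋯ k ] * f k         ≡⟨ cong (_* f k) (length-applyUpTo suc k) ⟩
    k * f k                      ∎
  ∑-hook : ∀ k → ∑ (hook k) f⊔ ≡ 2 * k * f k
  ∑-hook k = begin-equality
    ∑ (hook k) f⊔      ≡⟨ ∑-++ (map (k ,_) [1⋯ k ]) _ f⊔ ⟩
    _                  ≡⟨ cong₂ _+_ (∑-leg k (k ,_) (λ j≤k → cong f (m≥n⇒m⊔n≡m j≤k)))
                                    (∑-leg k (_, k) (λ j≤k → cong f (m≤n⇒m⊔n≡n j≤k))) ⟩
    k * f k + k * f k  ≡⟨ ((∀ k x → k * x + k * x ≡ 2 * k * x) ∋ solve-∀) k (f k) ⟩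
    2 * k * f k        ∎
  1≤ : ∀ {k} → k ∈ F → 1 ≤ k
  1≤ {k} k∈ = >-nonZero⁻¹ k {{All.lookup F>0 k∈}}
  ∈-hooks : ∀ {k p} → k ∈ F → (k ≡ 1 → p ≡ (1 , 1)) → p ∈ hook k → p ∈ (1 , 1) ∷ concatMap hook (without1 F)
  ∈-hooks {k} k∈ k≡1⇒ p∈ with k ℕ.≟ 1
  ... | yes k≡1 = here (k≡1⇒ k≡1)
  ... | no  k≢1 = there (∈-concatMap⁺ hook (Any.map (λ {refl → p∈}) (∈-filter⁺ (λ n → ¬? (n ℕ.≟ 1)) k∈ k≢1)))
  pairs⊆ : pairs F ⊆ (1 , 1) ∷ concatMap hook (without1 F)
  pairs⊆ {n , m} nm∈ with ∈-cartesianProduct⁻ F F nm∈ | ≤-total n m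
  ... | n∈ , m∈ | inj₁ n≤m = ∈-hooks m∈ (λ {refl → cong (_, 1) (≤-antisym n≤m (1≤ n∈))})
                               (∈-++⁺ʳ (map (m ,_) [1⋯ m ]) (∈-map⁺ (_, m) (∈-[1⋯]⁺ (1≤ n∈) n≤m)))
  ... | n∈ , m∈ | inj₂ m≤n = ∈-hooks n∈ (λ {refl → cong (1 ,_) (≤-antisym m≤n (1≤ m∈))})
                               (∈-++⁺ˡ (∈-map⁺ (n ,_) (∈-[1⋯]⁺ (1≤ m∈) m≤n)))

-- From natural to rational inequalities.

-- Gives access to explicit numerators and denominators, which normalisation in ℚ hides; sums,
-- products and comparisons below then reduce to integer arithmetic.
toℚᵘ-frac : ∀ a b → ℚ.toℚᵘ (frac a (suc b)) ℚᵘ.≃ mkℚᵘ (ℤ.+ a) b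
toℚᵘ-frac a b = ℚ.toℚᵘ-fromℚᵘ (mkℚᵘ (ℤ.+ a) b)

fromℕ-mono-≤ : ∀ {a b} → a ≤ b → fromℕ a ℚ.≤ fromℕ b
fromℕ-mono-≤ {a} {b} a≤b = ℚ.toℚᵘ-cancel-≤ (begin
  ℚ.toℚᵘ (fromℕ a)   ≃⟨ toℚᵘ-frac a 0 ⟩
  mkℚᵘ (ℤ.+ a) 0     ≤⟨ *≤* (ℤ.*-monoʳ-≤-nonNeg (ℤ.+ 1) (ℤ.+≤+ a≤b)) ⟩
  mkℚᵘ (ℤ.+ b) 0     ≃⟨ toℚᵘ-frac b 0 ⟨
  ℚ.toℚᵘ (fromℕ b)   ∎)
  where open ℚᵘ.≤-Reasoning

fromℕ-+ : ∀ a b → fromℕ (a + b) ≡ fromℕ a ℚ.+ fromℕ b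
fromℕ-+ a b = ℚ.toℚᵘ-injective (begin-equality
  ℚ.toℚᵘ (fromℕ (a + b))                        ≃⟨ toℚᵘ-frac (a + b) 0 ⟩
  mkℚᵘ (ℤ.+ (a + b)) 0                          ≃⟨ *≡* (cong (ℤ._* ℤ.+ 1) (cong₂ ℤ._+_ (sym (ℤ.*-identityʳ (ℤ.+ a))) (sym (ℤ.*-identityʳ (ℤ.+ b))))) ⟩
  mkℚᵘ (ℤ.+ a) 0 ℚᵘ.+ mkℚᵘ (ℤ.+ b) 0            ≃⟨ ℚᵘ.+-cong (toℚᵘ-frac a 0) (toℚᵘ-frac b 0) ⟨
  ℚ.toℚᵘ (fromℕ a) ℚᵘ.+ ℚ.toℚᵘ (fromℕ b)        ≃⟨ ℚ.toℚᵘ-homo-+ (fromℕ a) (fromℕ b) ⟨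
  ℚ.toℚᵘ (fromℕ a ℚ.+ fromℕ b)                  ∎)
  where open ℚᵘ.≤-Reasoning

fromℕ-≤-*frac : ∀ {a c k} → NonZero k → a * k ≤ c → fromℕ a ℚ.≤ fromℕ c ℚ.* frac 1 k
fromℕ-≤-*frac {a} {c} {suc k} _ ak≤c = ℚ.toℚᵘ-cancel-≤ (begin
  ℚ.toℚᵘ (fromℕ a)                                   ≃⟨ toℚᵘ-frac a 0 ⟩
  mkℚᵘ (ℤ.+ a) 0                                     ≤⟨ *≤* le ⟩
  mkℚᵘ (ℤ.+ c) 0 ℚᵘ.* mkℚᵘ (ℤ.+ 1) k                 ≃⟨ ℚᵘ.*-cong (toℚᵘ-frac c 0) (toℚᵘ-frac 1 k) ⟨
  ℚ.toℚᵘ (fromℕ c) ℚᵘ.* ℚ.toℚᵘ (frac 1 (suc k))      ≃⟨ ℚ.toℚᵘ-homo-* (fromℕ c) (frac 1 (suc k)) ⟨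
  ℚ.toℚᵘ (fromℕ c ℚ.* frac 1 (suc k))                ∎)
  where
  open ℚᵘ.≤-Reasoning
  -- The factor `suc (k + 0)` is the computed product of the denominators `1` and `suc k`; the two
  -- factors 1 on the right are the numerator of `1 / suc k` and the denominator of `a / 1`.
  le : ℤ.+ a ℤ.* ℤ.+ suc (k + 0) ℤ.≤ ℤ.+ c ℤ.* ℤ.+ 1 ℤ.* ℤ.+ 1
  le rewrite +-identityʳ k | ℤ.*-identityʳ (ℤ.+ c) | ℤ.*-identityʳ (ℤ.+ c) | sym (ℤ.pos-* a (suc k)) = ℤ.+≤+ ak≤c

fromℕ-∑-≤ : ∀ (xs : List A) (f : A → ℕ) (c : ℚ.ℚ) (g : A → ℚ.ℚ) →
            (∀ {x} → x ∈ xs → fromℕ (f x) ℚ.≤ c ℚ.* g x) → fromℕ (∑ xs f) ℚ.≤ c ℚ.* ∑ℚ xs g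
fromℕ-∑-≤ []       f c g le = ℚ.≤-reflexive (sym (ℚ.*-zeroʳ c))
fromℕ-∑-≤ (x ∷ xs) f c g le = begin
  fromℕ (f x + ∑ xs f)             ≡⟨ fromℕ-+ (f x) (∑ xs f) ⟩
  fromℕ (f x) ℚ.+ fromℕ (∑ xs f)   ≤⟨ ℚ.+-mono-≤ (le (here refl)) (fromℕ-∑-≤ xs f c g (λ x∈ → le (there x∈))) ⟩
  c ℚ.* g x ℚ.+ c ℚ.* ∑ℚ xs g      ≡⟨ ℚ.*-distribˡ-+ c (g x) (∑ℚ xs g) ⟨
  c ℚ.* (g x ℚ.+ ∑ℚ xs g)          ∎
  where open ℚ.≤-Reasoning

-- Classes of pairs in a factor closed set.

module _ {F : List ℕ} (FC : FactorClosed F) where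
  open FactorClosed FC

  ≢0 : ∀ {k} → k ∈ F → NonZero k
  ≢0 = All.lookup positive

  coprimePairs-unique : Unique (coprimePairs F)
  coprimePairs-unique = Unique.filter⁺ _ (pairs-unique unique)

  ∈-coprimePairs⁻ : ∀ {n m} → (n , m) ∈ coprimePairs F → n ∈ F × m ∈ F × Coprime n m
  ∈-coprimePairs⁻ nm∈ with ∈-filter⁻ (λ (n , m) → gcd n m ℕ.≟ 1) {xs = pairs F} nm∈
  ... | nm∈pairs , gcd≡1 = let n∈ , m∈ = ∈-cartesianProduct⁻ F F nm∈pairs in n∈ , m∈ , gcd≡1⇒coprime gcd≡1

  -- The condition `ν / μ = m / n` says `ν * n ≡ μ * m`, so (ν , μ) is a solution for (n , m):
  -- swapping coordinates matches the class with the solutions in `F`.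
  ratioCount≡solutionCount : ∀ {n m} → n ∈ F → ratioCount F n m ≡ solutionCount F n m
  ratioCount≡solutionCount {n} {m} n∈ = ≤-antisym
    (length-injection swap (cong swap) (Unique.filter⁺ ratio? (pairs-unique unique)) to)
    (length-injection swap (cong swap) (solutions-unique n m unique) from)
    where
    ratio? : Decidable (λ ((μ , ν) : ℕ × ℕ) → frac ν μ ≡ frac m n)
    ratio? (μ , ν) = frac ν μ ℚ.≟ frac m n
    to : ∀ {p} → p ∈ filter ratio? (pairs F) → swap p ∈ solutions F n m
    to {μ , ν} p∈ with ∈-filter⁻ ratio? {xs = pairs F} p∈
    ... | p∈pairs , eq = let μ∈ , ν∈ = ∈-cartesianProduct⁻ F F p∈pairs in
      ∈-solutions⁺ F n m ν∈ μ∈ (trans (frac-≡⁻ {ν} {μ} {m} {n} (≢0 μ∈) (≢0 n∈) eq) (*-comm m μ))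
    from : ∀ {p} → p ∈ solutions F n m → swap p ∈ filter ratio? (pairs F)
    from {ν , μ} p∈ = let ν∈ , μ∈ , eq = ∈-solutions⁻ F n m p∈ in
      ∈-filter⁺ ratio? (∈-cartesianProduct⁺ μ∈ ν∈) (frac-≡⁺ {ν} {μ} {m} {n} (≢0 μ∈) (≢0 n∈) (trans eq (*-comm μ m)))

  -- Exactly one coprime pair in `F` represents `ν / μ`, so the indicator leaves one term, and the
  -- solution count is constant on the class.
  solutionCount-∑ : ∀ {X μ ν} → Unique X → μ ∈ F → ν ∈ F →
    ∑ (coprimePairs F) (λ (n , m) → 𝟙 (frac ν μ ℚ.≟ frac m n) * solutionCount X n m) ≡ solutionCount X μ ν
  solutionCount-∑ {X} {μ} {ν} X! μ∈ ν∈ with coprime-reduction {μ} {ν} (≢0 μ∈)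
  ... | n , m , μ≡ , ν≡ , νn≡mμ , n⊥m =
    ∑-singleton (λ (n , m) → frac ν μ ℚ.≟ frac m n) _ coprimePairs-unique
      (∈-filter⁺ _ (∈-cartesianProduct⁺ n∈ m∈) (coprime⇒gcd≡1 n⊥m))
      ratio≡
      uniqueness
      (sym (solutionCount-proportional X! (≢0 μ∈) (≢0 n∈) νn≡mμ))
    where
    g = gcd μ ν
    -- Factor closedness enters here: `n` divides `μ` and `m` divides `ν`, so the reduced form stays
    -- in `F`.
    n∈ : n ∈ F
    n∈ = closed μ∈ (divides g (trans μ≡ (*-comm n g)))
    m∈ : m ∈ F
    m∈ = closed ν∈ (divides g (trans ν≡ (*-comm m g)))
    ratio≡ : frac ν μ ≡ frac m n
    ratio≡ = frac-≡⁺ {ν} {μ} {m} {n} (≢0 μ∈) (≢0 n∈) νn≡mμ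
    uniqueness : ∀ {p} → p ∈ coprimePairs F → frac ν μ ≡ frac (proj₂ p) (proj₁ p) → p ≡ (n , m)
    uniqueness {n′ , m′} p∈ eq =
      let n′∈ , _ , n′⊥m′ = ∈-coprimePairs⁻ p∈
          n′≡n , m′≡m = coprime-fraction-unique n′⊥m′ n⊥m
            (frac-≡⁻ {m′} {n′} {m} {n} (≢0 n′∈) (≢0 n∈) (trans (sym eq) ratio≡))
      in cong₂ _,_ n′≡n m′≡m

  -- Expand each solution count by `solutionCount-∑` and interchange the sums; the indicators then
  -- add up to the class size. Leaving `X` general covers both [1 , B] and `F`.
  N≡∑-coprimePairs : ∀ X → Unique X →
    N X F ≡ ∑ (coprimePairs F) (λ (n , m) → ratioCount F n m * solutionCount X n m)
  N≡∑-coprimePairs X X! = begin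
    N X F
      ≡⟨ N≡∑-solutionCount X F ⟩
    ∑ (pairs F) (λ (μ , ν) → solutionCount X μ ν)
      ≡⟨ ∑-cong (pairs F) (λ p∈ → let μ∈ , ν∈ = ∈-cartesianProduct⁻ F F p∈ in sym (solutionCount-∑ X! μ∈ ν∈)) ⟩
    ∑ (pairs F) (λ (μ , ν) → ∑ (coprimePairs F) (λ (n , m) → 𝟙 (frac ν μ ℚ.≟ frac m n) * solutionCount X n m))
      ≡⟨ ∑-comm (pairs F) (coprimePairs F) _ ⟩
    ∑ (coprimePairs F) (λ (n , m) → ∑ (pairs F) (λ (μ , ν) → 𝟙 (frac ν μ ℚ.≟ frac m n) * solutionCount X n m))
      ≡⟨ ∑-cong (coprimePairs F) (λ {(n , m)} _ → trans (∑-*ʳ (pairs F) _ (solutionCount X n m))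
           (cong (_* solutionCount X n m) (sym (length-filter _ (pairs F))))) ⟩
    ∑ (coprimePairs F) (λ (n , m) → ratioCount F n m * solutionCount X n m)
      ∎
    where open ≡-Reasoning

  N-interval : ∀ B → N [1⋯ B ] F ≡ ∑ (coprimePairs F) (λ (n , m) → ratioCount F n m * ⌊ B / n ⊔ m ⌋)
  N-interval B = trans (N≡∑-coprimePairs [1⋯ B ] ([1⋯]-unique B)) (∑-cong (coprimePairs F) λ {(n , m)} p∈ →
    let n∈ , m∈ , n⊥m = ∈-coprimePairs⁻ p∈ in
    cong (ratioCount F n m *_) (solutionCount-coprime B n⊥m (≢0 n∈) (≢0 m∈)))

  N-square : N F F ≡ ∑ (coprimePairs F) (λ (n , m) → ratioCount F n m ^ 2)
  N-square = trans (N≡∑-coprimePairs F unique) (∑-cong (coprimePairs F) λ {(n , m)} p∈ →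
    let n∈ , _ = ∈-coprimePairs⁻ p∈ in
    -- The power `x ^ 2` unfolds to `x * (x * 1)`, hence the last identity.
    cong (ratioCount F n m *_) (trans (sym (ratioCount≡solutionCount n∈)) (sym (*-identityʳ _))))

  -- Bounds for `F` inside [1 , B].

  module _ {B : ℕ} (F⊂ : F ⊂[1, B ]) where

    F⊆[1⋯] : F ⊆ [1⋯ B ]
    F⊆[1⋯] k∈ = let 1≤k , k≤B = All.lookup F⊂ k∈ in ∈-[1⋯]⁺ 1≤k k≤B

    -- The estimate holds term by term over `pairs F`, before any grouping into classes.
    N-lower : N [1⋯ B ] F ≥ ∑ (pairs F) (λ (μ , ν) → gcd μ ν)
    N-lower = subst (∑ (pairs F) (λ (μ , ν) → gcd μ ν) ≤_) (sym (N≡∑-solutionCount [1⋯ B ] F))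
      (∑-mono-≤ (pairs F) λ p∈ → let μ∈ , ν∈ = ∈-cartesianProduct⁻ F F p∈ in
        solutionCount-gcd (All.lookup F⊂ μ∈) (All.lookup F⊂ ν∈))

    ratioCount≤ : ∀ {n m} → n ∈ F → m ∈ F → Coprime n m → ratioCount F n m ≤ ⌊ B / n ⊔ m ⌋
    ratioCount≤ {n} {m} n∈ m∈ n⊥m = begin
      ratioCount F n m           ≡⟨ ratioCount≡solutionCount n∈ ⟩
      solutionCount F n m        ≤⟨ solutionCount-⊆ n m unique F⊆[1⋯] ⟩
      solutionCount [1⋯ B ] n m  ≡⟨ solutionCount-coprime B n⊥m (≢0 n∈) (≢0 m∈) ⟩
      ⌊ B / n ⊔ m ⌋              ∎
      where open ≤-Reasoning

    -- Bound each class size by `⌊ B / n ⊔ m ⌋`, enlarge the sum from coprime pairs to all pairs,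
    -- and group by maximum.
    N-upper-ℕ : N [1⋯ B ] F ≤ ∑ (without1 F) (λ k → 2 * k * ⌊ B / k ⌋ ^ 2) + B ^ 2
    N-upper-ℕ = begin
      N [1⋯ B ] F
        ≡⟨ N-interval B ⟩
      ∑ (coprimePairs F) (λ (n , m) → ratioCount F n m * ⌊ B / n ⊔ m ⌋)
        ≤⟨ ∑-mono-≤ (coprimePairs F) (λ {(n , m)} p∈ → let n∈ , m∈ , n⊥m = ∈-coprimePairs⁻ p∈ in
             *-mono-≤ (ratioCount≤ n∈ m∈ n⊥m) (≤-reflexive (sym (*-identityʳ _)))) ⟩
      ∑ (coprimePairs F) (λ (n , m) → ⌊ B / n ⊔ m ⌋ ^ 2)
        ≤⟨ ∑-⊆ _ coprimePairs-unique (λ p∈ → proj₁ (∈-filter⁻ (λ (n , m) → gcd n m ℕ.≟ 1) {xs = pairs F} p∈)) ⟩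
      ∑ (pairs F) (λ (n , m) → ⌊ B / n ⊔ m ⌋ ^ 2)
        ≤⟨ ∑-pairs-max F (λ k → ⌊ B / k ⌋ ^ 2) unique positive ⟩
      ∑ (without1 F) (λ k → 2 * k * ⌊ B / k ⌋ ^ 2) + ⌊ B / 1 ⌋ ^ 2
        ≤⟨ +-monoʳ-≤ _ (^-monoˡ-≤ 2 {⌊ B / 1 ⌋} (subst (_≤ B) (*-identityʳ _) (⌊/⌋-upper B 1))) ⟩
      ∑ (without1 F) (λ k → 2 * k * ⌊ B / k ⌋ ^ 2) + B ^ 2
        ∎
      where open ≤-Reasoning

    N-upper : fromℕ (N [1⋯ B ] F) ℚ.≤ fromℕ (2 * B ^ 2) ℚ.* ∑ℚ (without1 F) (λ n → frac 1 n) ℚ.+ fromℕ (B ^ 2)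
    N-upper = begin
      fromℕ (N [1⋯ B ] F)
        ≤⟨ fromℕ-mono-≤ N-upper-ℕ ⟩
      fromℕ (∑ (without1 F) (λ k → 2 * k * ⌊ B / k ⌋ ^ 2) + B ^ 2)
        ≡⟨ fromℕ-+ (∑ (without1 F) (λ k → 2 * k * ⌊ B / k ⌋ ^ 2)) (B ^ 2) ⟩
      fromℕ (∑ (without1 F) (λ k → 2 * k * ⌊ B / k ⌋ ^ 2)) ℚ.+ fromℕ (B ^ 2)
        ≤⟨ ℚ.+-monoˡ-≤ (fromℕ (B ^ 2)) (fromℕ-∑-≤ (without1 F) _ (fromℕ (2 * B ^ 2)) (frac 1) λ {k} k∈ →
             fromℕ-≤-*frac {2 * k * ⌊ B / k ⌋ ^ 2} {2 * B ^ 2} (≢0 (proj₁ (∈-filter⁻ (λ n → ¬? (n ℕ.≟ 1)) {xs = F} k∈))) (bound k)) ⟩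
      fromℕ (2 * B ^ 2) ℚ.* ∑ℚ (without1 F) (λ n → frac 1 n) ℚ.+ fromℕ (B ^ 2)
        ∎
      where
      open ℚ.≤-Reasoning
      -- This is `2 k q² ≤ 2 B² / k` for `q = ⌊ B / k ⌋`, cleared of its denominator; it comes from
      -- squaring `q * k ≤ B`.
      bound : ∀ k → 2 * k * ⌊ B / k ⌋ ^ 2 * k ≤ 2 * B ^ 2
      bound k = subst (_≤ 2 * B ^ 2) (((∀ q k → 2 * (q * k * (q * k * 1)) ≡ 2 * k * (q * (q * 1)) * k) ∋ solve-∀) ⌊ B / k ⌋ k)
        (*-monoʳ-≤ 2 (^-monoˡ-≤ 2 (⌊/⌋-upper B k)))

proposition1p1 : (F : List ℕ) → FactorClosed F → (B : ℕ) → 1 ≤ B →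
    (N [1⋯ B ] F ≡ ∑ (coprimePairs F) (λ (n , m) → ratioCount F n m * ⌊ B / n ⊔ m ⌋))
    × (F ⊂[1, B ] →
    (fromℕ (N [1⋯ B ] F) ℚ.≤ fromℕ (2 * B ^ 2) ℚ.* ∑ℚ (without1 F) (λ n → frac 1 n) ℚ.+ fromℕ (B ^ 2))
    × (N [1⋯ B ] F ≥ ∑ (pairs F) (λ (μ , ν) → gcd μ ν))
    × (N F F ≡ ∑ (coprimePairs F) (λ (n , m) → ratioCount F n m ^ 2)))
proposition1p1 F FC B _ = N-interval FC B , λ F⊂ → N-upper FC F⊂ , N-lower FC F⊂ , N-square FC
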